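{- For any integer $N>1$, there are at most $2(N-1)$ integer triples $(a,b,c)$ with $0<a+1<b<c$, $c-a=N$ and $P_a+P_c=2P_b$.
   Context: For an integer $n$, $P_n=\frac{n(n+1)(2n+1)}{6}$ (for $n\ge 1$ this is $\sum_{k=1}^n k^2$, the $n$th square pyramidal number). For $0<a+1<b<c$ the equation $P_a+P_c=2P_b$ is equivalent to $(a+1)^2+\cdots+b^2=(b+1)^2+\cdots+c^2$. -}

module Defs where

open import Data.Integer using (ℤ; _+_; _*_; _-_; _<_; _/_; +_)
open import Data.Product using (_×_; _,_)

-- P n = n(n+1)(2n+1)/6 for an integer n (the division is exact).
P : ℤ → ℤ
P n = (n * (n + + 1) * (+ 2 * n + + 1)) / + 6

-- The conditions on a triple (a,b,c) for a given N:
-- 0 < a+1 < b < c,  c - a = N,  P a + P c = 2 P b.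
Good : ℤ → ℤ × ℤ × ℤ → Set
Good N (a , b , c) =
  (+ 0 < a + + 1) × (a + + 1 < b) × (b < c) × (c - a ≡ N) × (P a + P c ≡ + 2 * P b)
  where open import Relation.Binary.PropositionalEquality using (_≡_)

{-# OPTIONS --safe #-}
-- Write b = a + x and c = a + N. As 6 P n = n (n + 1) (2 n + 1) for n ≥ 0, the equation
-- P a + P c = 2 P b says that a is a root of a quadratic q whose coefficients depend only on N
-- and x, and q is nondegenerate because x ≠ 0. A nondegenerate quadratic has at most two roots,
-- told apart by the sign of q′ there, so a good triple is determined by x ∈ {1, …, N - 1}
-- together with a sign: at most 2 (N - 1) possibilities.
module Submission where

open import Defs
open import Data.Integer using (ℤ; _<_; _≤_; _*_; _-_; +_)
open import Data.Product using (_×_)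
open import Data.List using (List; length)
open import Data.List.Relation.Unary.All using (All)
open import Data.List.Relation.Unary.Unique.Propositional using (Unique)

open import Data.Fin.Base using (Fin; zero; suc; toℕ; fromℕ<; combine)
open import Data.Fin.Properties using (injective⇒≤; combine-injective; toℕ-fromℕ<)
open import Data.Integer.Base using (0ℤ; -[1+_]; _+_; -_; sign; _/_; +≤+; +<+)
open import Data.Integer.Properties
  using (+-identityˡ; +-comm; +-inverseʳ; +-monoˡ-<; <-trans; <⇒≤; <⇒≢; suc[i]≤j⇒i<j;
         i≡j⇒i-j≡0; i-j≡0⇒i≡j; *-assoc; *-distribʳ-+; *-identityˡ; i*j≡0⇒i≡0∨j≡0;
         pos-*; pos-+; _≟_; module ≤-Reasoning)
open import Data.Integer.Tactic.RingSolver using (solve-∀; solve)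
open import Data.List.Base using (lookup; _∷_; [])
open import Data.List.Membership.Propositional.Properties using (∈-lookup)
open import Data.List.Relation.Unary.AllPairs using (_∷_)
import Data.List.Relation.Unary.All as All
open import Data.Nat.Base as ℕ using (ℕ; zero; suc; z≤n; s<s)
open import Data.Nat.DivMod using (m*n/n≡m)
open import Data.Product using (Σ; _,_; proj₁; proj₂)
open import Data.Sign.Base as Sign using (Sign)
open import Data.Sum using ([_,_]′)
open import Function.Base using (id; _∘_)
open import Function.Definitions using (Injective)
open import Relation.Binary.PropositionalEquality
  using (_≡_; _≢_; refl; sym; trans; cong; cong₂; subst; ≢-sym; module ≡-Reasoning)
open import Relation.Nullary using (¬_; yes; no; contradiction)

module _ {a} {A : Set a} where

  Unique⇒lookup-injective : ∀ {xs : List A} → Unique xs → Injective _≡_ _≡_ (lookup xs)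
  Unique⇒lookup-injective (_    ∷ _)   {zero}  {zero}  _  = refl
  Unique⇒lookup-injective (x∉xs ∷ _)   {zero}  {suc j} eq =
    contradiction eq (All.lookup x∉xs (∈-lookup j))
  Unique⇒lookup-injective (x∉xs ∷ _)   {suc i} {zero}  eq =
    contradiction (sym eq) (All.lookup x∉xs (∈-lookup i))
  Unique⇒lookup-injective (_    ∷ xs!) {suc i} {suc j} eq =
    cong suc (Unique⇒lookup-injective xs! eq)

  Unique⇒length≤ : ∀ {p} {P : A → Set p} {M} (code : ∀ {x} → P x → Fin M) →
                   (∀ {x y} (px : P x) (py : P y) → code px ≡ code py → x ≡ y) →
                   ∀ {xs} → Unique xs → All P xs → length xs ℕ.≤ M
  Unique⇒length≤ code code-injective xs! pxs =
    injective⇒≤ {f = code ∘ All.lookup pxs ∘ ∈-lookup}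
      (Unique⇒lookup-injective xs! ∘ code-injective _ _)

i*j≡0⇒j≡0 : ∀ {i j} → i ≢ 0ℤ → i * j ≡ 0ℤ → j ≡ 0ℤ
i*j≡0⇒j≡0 {i} i≢0 eq =
  [ (λ i≡0 → contradiction i≡0 i≢0) , id ]′ (i*j≡0⇒i≡0∨j≡0 i eq)

sign[i]≡sign[j]∧i+j≡0⇒i≡0 : ∀ i j → sign i ≡ sign j → i + j ≡ 0ℤ → i ≡ 0ℤ
sign[i]≡sign[j]∧i+j≡0⇒i≡0 (+ zero) (+ _) _ _ = refl
sign[i]≡sign[j]∧i+j≡0⇒i≡0 -[1+ _ ] -[1+ _ ] _ ()

record Quadratic : Set where
  constructor quadratic
  field
    α β γ : ℤ

open Quadratic

eval : Quadratic → ℤ → ℤ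
eval (quadratic α β γ) t = α * t * t + β * t + γ

slope : Quadratic → ℤ → ℤ
slope (quadratic α β _) t = + 2 * α * t + β

-- Distinct roots s, t force α (s + t) + β = 0, so the slopes at s and t are opposite;
-- equal signs then make both slopes 0, which forces α = β = 0.
roots-separated-by-slope-sign :
  ∀ q {s t} → ¬ (α q ≡ 0ℤ × β q ≡ 0ℤ) → eval q s ≡ 0ℤ → eval q t ≡ 0ℤ →
  sign (slope q s) ≡ sign (slope q t) → s ≡ t
roots-separated-by-slope-sign q@(quadratic α β γ) {s} {t} nondegenerate qs≡0 qt≡0 same-sign
  with s ≟ t
... | yes s≡t = s≡t
... | no s≢t = contradiction (α≡0 , β≡0) nondegenerate
  where
  open ≡-Reasoning

  s-t≢0 : s - t ≢ 0ℤ
  s-t≢0 = s≢t ∘ i-j≡0⇒i≡j s t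

  middle≡0 : α * (s + t) + β ≡ 0ℤ
  middle≡0 = i*j≡0⇒j≡0 s-t≢0 (begin
    (s - t) * (α * (s + t) + β)                      ≡⟨ solve (α ∷ β ∷ γ ∷ s ∷ t ∷ []) ⟩
    α * s * s + β * s + γ - (α * t * t + β * t + γ)  ≡⟨ cong₂ _-_ qs≡0 qt≡0 ⟩
    0ℤ                                               ∎)

  slope-sum≡0 : slope q s + slope q t ≡ 0ℤ
  slope-sum≡0 = begin
    (+ 2 * α * s + β) + (+ 2 * α * t + β) ≡⟨ solve (α ∷ β ∷ s ∷ t ∷ []) ⟩
    + 2 * (α * (s + t) + β)               ≡⟨ cong (+ 2 *_) middle≡0 ⟩
    0ℤ                                    ∎

  slope-s≡0 : slope q s ≡ 0ℤ
  slope-s≡0 = sign[i]≡sign[j]∧i+j≡0⇒i≡0 _ _ same-sign slope-sum≡0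

  slope-t≡0 : slope q t ≡ 0ℤ
  slope-t≡0 = sign[i]≡sign[j]∧i+j≡0⇒i≡0 _ _ (sym same-sign)
    (trans (+-comm (slope q t) (slope q s)) slope-sum≡0)

  α≡0 : α ≡ 0ℤ
  α≡0 = i*j≡0⇒j≡0 {+ 2} (λ ()) (i*j≡0⇒j≡0 s-t≢0 (begin
    (s - t) * (+ 2 * α)                   ≡⟨ solve (α ∷ β ∷ s ∷ t ∷ []) ⟩
    (+ 2 * α * s + β) - (+ 2 * α * t + β) ≡⟨ cong₂ _-_ slope-s≡0 slope-t≡0 ⟩
    0ℤ                                    ∎))

  β≡0 : β ≡ 0ℤ
  β≡0 = trans (sym (+-identityˡ β)) (subst (λ α → α * (s + t) + β ≡ 0ℤ) α≡0 middle≡0)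

cubic : ℤ → ℤ
cubic n = n * (n + + 1) * (+ 2 * n + + 1)

-- The ring solver treats cubic as opaque, so here and in eval-defect the identity is
-- proved in expanded form.
cubic-suc : ∀ i → cubic (+ 1 + i) ≡ cubic i + (+ 1 + i) * (+ 1 + i) * + 6
cubic-suc = expanded
  where
  expanded : ∀ i → (+ 1 + i) * (+ 1 + i + + 1) * (+ 2 * (+ 1 + i) + + 1)
                 ≡ i * (i + + 1) * (+ 2 * i + + 1) + (+ 1 + i) * (+ 1 + i) * + 6
  expanded = solve-∀

sumOfSquares : ℕ → ℕ
sumOfSquares zero    = 0
sumOfSquares (suc n) = sumOfSquares n ℕ.+ suc n ℕ.* suc n

cubic≡sumOfSquares*6 : ∀ n → cubic (+ n) ≡ + sumOfSquares n * + 6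
cubic≡sumOfSquares*6 zero    = refl
cubic≡sumOfSquares*6 (suc n) = begin
  cubic (+ suc n)                        ≡⟨ cubic-suc (+ n) ⟩
  cubic (+ n) + + suc n * + suc n * + 6  ≡⟨ cong₂ _+_ (cubic≡sumOfSquares*6 n)
                                                      (cong (_* + 6) (sym (pos-* (suc n) (suc n)))) ⟩
  + S * + 6 + + n²′ * + 6                ≡⟨ *-distribʳ-+ (+ 6) (+ S) (+ n²′) ⟨
  (+ S + + n²′) * + 6                    ≡⟨ cong (_* + 6) (pos-+ S n²′) ⟨
  + sumOfSquares (suc n) * + 6           ∎
  where
  open ≡-Reasoning
  S   = sumOfSquares n
  n²′ = suc n ℕ.* suc n

P≡sumOfSquares : ∀ n → P (+ n) ≡ + sumOfSquares n
P≡sumOfSquares n = begin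
  cubic (+ n) / + 6                        ≡⟨ cong (_/ + 6) (cubic≡sumOfSquares*6 n) ⟩
  + sumOfSquares n * + 6 / + 6             ≡⟨ cong (_/ + 6) (sym (pos-* (sumOfSquares n) 6)) ⟩
  -- i / + 6 unfolds to + 1 * (i /ℕ 6)
  + 1 * + (sumOfSquares n ℕ.* 6 ℕ./ 6)     ≡⟨ *-identityˡ _ ⟩
  + (sumOfSquares n ℕ.* 6 ℕ./ 6)           ≡⟨ cong +_ (m*n/n≡m (sumOfSquares n) 6) ⟩
  + sumOfSquares n                         ∎
  where open ≡-Reasoning

P*6≡cubic : ∀ {n} → + 0 ≤ n → P n * + 6 ≡ cubic n
P*6≡cubic {+ n} _ = begin
  P (+ n) * + 6           ≡⟨ cong (_* + 6) (P≡sumOfSquares n) ⟩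
  + sumOfSquares n * + 6  ≡⟨ sym (cubic≡sumOfSquares*6 n) ⟩
  cubic (+ n)             ∎
  where open ≡-Reasoning

P-equation⇒cubic-equation : ∀ {a b c} → + 0 ≤ a → + 0 ≤ b → + 0 ≤ c →
                            P a + P c ≡ + 2 * P b → cubic a + cubic c ≡ + 2 * cubic b
P-equation⇒cubic-equation {a} {b} {c} 0≤a 0≤b 0≤c eq = begin
  cubic a + cubic c           ≡⟨ sym (cong₂ _+_ (P*6≡cubic 0≤a) (P*6≡cubic 0≤c)) ⟩
  P a * + 6 + P c * + 6       ≡⟨ sym (*-distribʳ-+ (+ 6) (P a) (P c)) ⟩
  (P a + P c) * + 6           ≡⟨ cong (_* + 6) eq ⟩
  + 2 * P b * + 6             ≡⟨ *-assoc (+ 2) (P b) (+ 6) ⟩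
  + 2 * (P b * + 6)           ≡⟨ cong (+ 2 *_) (P*6≡cubic 0≤b) ⟩
  + 2 * cubic b               ∎
  where open ≡-Reasoning

defect : ℤ → ℤ → Quadratic
defect N x = quadratic (+ 6 * (N - + 2 * x))
                       (+ 6 * (N * N + N - + 2 * (x * x) - + 2 * x))
                       (cubic N - + 2 * cubic x)

eval-defect : ∀ N x a → eval (defect N x) a ≡ cubic a + cubic (a + N) - + 2 * cubic (a + x)
eval-defect = expanded
  where
  expanded : ∀ N x a →
    + 6 * (N - + 2 * x) * a * a + + 6 * (N * N + N - + 2 * (x * x) - + 2 * x) * a
      + (N * (N + + 1) * (+ 2 * N + + 1) - + 2 * (x * (x + + 1) * (+ 2 * x + + 1)))
    ≡ a * (a + + 1) * (+ 2 * a + + 1) + (a + N) * (a + N + + 1) * (+ 2 * (a + N) + + 1)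
      - + 2 * ((a + x) * (a + x + + 1) * (+ 2 * (a + x) + + 1))
  expanded = solve-∀

defect-nondegenerate : ∀ N {x} → x ≢ 0ℤ → ¬ (α (defect N x) ≡ 0ℤ × β (defect N x) ≡ 0ℤ)
defect-nondegenerate N {x} x≢0 (α≡0 , β≡0) =
  x≢0 ([ id , id ]′ (i*j≡0⇒i≡0∨j≡0 x (i*j≡0⇒j≡0 {+ 12} (λ ()) (begin
    + 12 * (x * x)                       ≡⟨ solve (N ∷ x ∷ []) ⟩
    + 6 * (N * N + N - + 2 * (x * x) - + 2 * x) - + 6 * (N - + 2 * x) * (N + + 2 * x + + 1)
                                         ≡⟨ cong₂ (λ u v → u - v * (N + + 2 * x + + 1)) β≡0 α≡0 ⟩
    0ℤ                                   ∎))))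
  where open ≡-Reasoning

i+[j-i]≡j : ∀ i j → i + (j - i) ≡ j
i+[j-i]≡j = solve-∀

0<i+1⇒0≤i : ∀ {i} → + 0 < i + + 1 → + 0 ≤ i
0<i+1⇒0≤i {+ _}        _        = +≤+ z≤n
0<i+1⇒0≤i { -[1+ 0 ]} (+<+ ())

0<i<1+m⇒∃fin : ∀ {m i} → + 0 < i → i < + suc m → Σ (Fin m) λ k → i ≡ + suc (toℕ k)
0<i<1+m⇒∃fin {i = + suc n} _ (+<+ (s<s n<m)) =
  fromℕ< n<m , cong (+_ ∘ suc) (sym (toℕ-fromℕ< n<m))
0<i<1+m⇒∃fin {i = + 0} (+<+ ())

module _ {N a b c : ℤ} (good : Good N (a , b , c)) where

  private
    0<a+1 = proj₁ good
    a+1<b = proj₁ (proj₂ good)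
    b<c   = proj₁ (proj₂ (proj₂ good))
    c-a≡N = proj₁ (proj₂ (proj₂ (proj₂ good)))
    P-eq  = proj₂ (proj₂ (proj₂ (proj₂ good)))

  good⇒c≡a+N : c ≡ a + N
  good⇒c≡a+N = trans (sym (i+[j-i]≡j a c)) (cong (_+_ a) c-a≡N)

  good⇒gap-bounds : + 0 < b - a × b - a < N
  good⇒gap-bounds =
    subst (_< b - a) (+-inverseʳ a) (+-monoˡ-< (- a) a<b) ,
    subst (b - a <_) c-a≡N (+-monoˡ-< (- a) b<c)
    where
    a<b : a < b
    a<b = suc[i]≤j⇒i<j (subst (_≤ b) (+-comm a (+ 1)) (<⇒≤ a+1<b))

  good⇒root : eval (defect N (b - a)) a ≡ 0ℤ
  good⇒root = begin
    eval (defect N (b - a)) a                            ≡⟨ eval-defect N (b - a) a ⟩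
    cubic a + cubic (a + N) - + 2 * cubic (a + (b - a))
      ≡⟨ cong₂ (λ u v → cubic a + cubic u - + 2 * cubic v) (sym good⇒c≡a+N) (i+[j-i]≡j a b) ⟩
    cubic a + cubic c - + 2 * cubic b
      ≡⟨ i≡j⇒i-j≡0 (P-equation⇒cubic-equation 0≤a 0≤b 0≤c P-eq) ⟩
    0ℤ                                                   ∎
    where
    open ≡-Reasoning
    0≤a : + 0 ≤ a
    0≤a = 0<i+1⇒0≤i 0<a+1
    0<b : + 0 < b
    0<b = <-trans 0<a+1 a+1<b
    0≤b : + 0 ≤ b
    0≤b = <⇒≤ 0<b
    0≤c : + 0 ≤ c
    0≤c = <⇒≤ (<-trans 0<b b<c)

slope-sign : ℤ → ℤ × ℤ × ℤ → Sign
slope-sign N (a , b , _) = sign (slope (defect N (b - a)) a)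

good-determined : ∀ {N a₁ b₁ c₁ a₂ b₂ c₂} →
                  Good N (a₁ , b₁ , c₁) → Good N (a₂ , b₂ , c₂) → b₁ - a₁ ≡ b₂ - a₂ →
                  slope-sign N (a₁ , b₁ , c₁) ≡ slope-sign N (a₂ , b₂ , c₂) →
                  (a₁ , b₁ , c₁) ≡ (a₂ , b₂ , c₂)
good-determined {N} {a₁} {b₁} {c₁} {a₂} {b₂} {c₂} g₁ g₂ gaps≡ signs≡ = begin
  (a₁ , b₁ , c₁)                  ≡⟨ shape g₁ ⟩
  (a₁ , a₁ + (b₁ - a₁) , a₁ + N)  ≡⟨ cong₂ (λ a x → a , a + x , a + N) a₁≡a₂ gaps≡ ⟩
  (a₂ , a₂ + (b₂ - a₂) , a₂ + N)  ≡⟨ shape g₂ ⟨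
  (a₂ , b₂ , c₂)                  ∎
  where
  open ≡-Reasoning

  shape : ∀ {a b c} → Good N (a , b , c) → (a , b , c) ≡ (a , a + (b - a) , a + N)
  shape {a} {b} g = cong₂ (λ u v → a , u , v) (sym (i+[j-i]≡j a b)) (good⇒c≡a+N g)

  a₁≡a₂ : a₁ ≡ a₂
  a₁≡a₂ = roots-separated-by-slope-sign (defect N (b₁ - a₁))
    (defect-nondegenerate N (≢-sym (<⇒≢ (proj₁ (good⇒gap-bounds g₁)))))
    (good⇒root g₁)
    (subst (λ x → eval (defect N x) a₂ ≡ 0ℤ) (sym gaps≡) (good⇒root g₂))
    (trans signs≡ (cong (λ x → sign (slope (defect N x) a₂)) (sym gaps≡)))

signIndex : Sign → Fin 2
signIndex Sign.- = zero
signIndex Sign.+ = suc zero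

signIndex-injective : Injective _≡_ _≡_ signIndex
signIndex-injective {Sign.-} {Sign.-} _ = refl
signIndex-injective {Sign.+} {Sign.+} _ = refl

gap-index : ∀ {m a b c} → Good (+ suc m) (a , b , c) →
            Σ (Fin m) λ k → b - a ≡ + suc (toℕ k)
gap-index g = 0<i<1+m⇒∃fin (proj₁ (good⇒gap-bounds g)) (proj₂ (good⇒gap-bounds g))

code : ∀ m {t} → Good (+ suc m) t → Fin (2 ℕ.* m)
code m {t} g = combine (signIndex (slope-sign (+ suc m) t)) (proj₁ (gap-index g))

code-injective : ∀ m {t u} (g : Good (+ suc m) t) (h : Good (+ suc m) u) →
                 code m g ≡ code m h → t ≡ u
code-injective m {a₁ , b₁ , _} {a₂ , b₂ , _} g h eq
  with combine-injective _ _ _ _ eq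
... | signs≡ , indices≡ = good-determined g h gaps≡ (signIndex-injective signs≡)
  where
  open ≡-Reasoning
  gaps≡ : b₁ - a₁ ≡ b₂ - a₂
  gaps≡ = begin
    b₁ - a₁                                ≡⟨ proj₂ (gap-index g) ⟩
    + suc (toℕ (proj₁ (gap-index g)))      ≡⟨ cong (+_ ∘ suc ∘ toℕ) indices≡ ⟩
    + suc (toℕ (proj₁ (gap-index h)))      ≡⟨ proj₂ (gap-index h) ⟨
    b₂ - a₂                                ∎

theorem2p1 : (N : ℤ) → + 1 < N → (ts : List (ℤ × ℤ × ℤ)) → Unique ts → All (Good N) ts →
    + (length ts) ≤ + 2 * (N - + 1)
theorem2p1 (+ 0) (+<+ ())
theorem2p1 (+ suc m) _ ts ts! good = begin
  + length ts            ≤⟨ +≤+ (Unique⇒length≤ (code m) (code-injective m) ts! good) ⟩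
  + (2 ℕ.* m)            ≡⟨ pos-* 2 m ⟩
  + 2 * (+ suc m - + 1)  ∎
  where open ≤-Reasoning
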